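{- Let $b \ge 3$ be an integer. An integer $n \ge b^2-1$ is not the comma-successor in base $b$ of any positive integer if and only if $n = c\cdot b^i$ for some integers $i \ge 2$ and $2 \le c \le b-1$.
   Context: Fix a base $b$. For a positive integer $n$, let $\delta(n)$ denote its leading (most significant, nonzero) base-$b$ digit. For positive integers $k, k'$, we say that $k'$ is a comma-child of $k$ (in base $b$) if $k' - k = d\cdot b + \delta(k')$, where $d = k \bmod b$ is the last base-$b$ digit of $k$. If $k$ has at least one comma-child, the comma-successor of $k$ is its smallest comma-child; otherwise $k$ has no comma-successor. -}

module Defs where

open import Data.Digit using (Digit; Expansion; fromDigits)
open import Data.Fin.Base using (toℕ)
open import Data.List.Base using (_∷ʳ_)
open import Data.Nat.Base using (ℕ; _+_; _*_; _%_; _≤_; NonZero)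
open import Data.Product.Base using (_×_; ∃-syntax)
open import Relation.Binary.PropositionalEquality.Core using (_≡_; _≢_)

-- IsLeadingDigit b n x says δ(n) = x. Expansions list the least significant
-- digit first, so the most significant digit x is the final one.  There is
-- exactly one such x when b ≥ 2 and n is positive, and none when n is 0.
IsLeadingDigit : (b n : ℕ) → Digit b → Set
IsLeadingDigit b n x =
  toℕ x ≢ 0 × ∃[ ds ] fromDigits {b} (ds ∷ʳ x) ≡ n

-- The equation k′ - k = (k mod b) * b + δ(k′), with k moved to the right so
-- as to avoid truncated subtraction.
CommaChild : (b : ℕ) .{{_ : NonZero b}} → (k k′ : ℕ) → Set
CommaChild b k k′ =
  ∃[ x ] IsLeadingDigit b k′ x × k′ ≡ k + ((k % b) * b + toℕ x)

IsCommaSuccessor : (b : ℕ) .{{_ : NonZero b}} → (k k′ : ℕ) → Set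
IsCommaSuccessor b k k′ =
  CommaChild b k k′ × (∀ m → CommaChild b k m → k′ ≤ m)

{-# OPTIONS --safe #-}

-- Write δ for the leading digit.  When n ≥ b² ∸ 1, the equation
-- n = k + (k mod b) b + δ(n) has exactly one solution k: the number n ∸ δ(n)
-- has the same last digit d as k, so k = n ∸ δ(n) ∸ d b, and the bound on n
-- keeps this positive.  Hence n fails to be a comma-successor only when its
-- unique parent k has a smaller child n′.  Then n′ < n, δ(n′) < δ(n) and
-- n ∸ n′ = δ(n) ∸ δ(n′) < b, so the leading digit drops within fewer than b
-- steps below n.  This forces δ(n′) = δ(n) ∸ 1, n′ = n ∸ 1 and n = δ(n) bʲ.
-- Conversely, if n = c bⁱ with c ≥ 2, then n ∸ 1 has leading digit c ∸ 1 and is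
-- therefore a child of every parent of n.
module Submission where

open import Defs
open import Data.Digit using (fromDigits)
open import Data.Empty using (⊥-elim)
open import Data.Fin.Base using (Fin; toℕ; fromℕ<)
open import Data.Fin.Properties using (toℕ-fromℕ<; toℕ<n)
open import Data.List.Base using ([]; _∷_; _∷ʳ_)
open import Data.Nat.Base
open import Data.Nat.DivMod
open import Data.Nat.Properties
open import Data.Nat.Solver using (module +-*-Solver)
open import Data.Product.Base using (_×_; _,_; ∃-syntax)
open import Data.Sum.Base using (inj₁; inj₂)
open import Function.Bundles using (_⇔_; mk⇔)
open import Relation.Binary.PropositionalEquality
  using (_≡_; _≢_; refl; sym; trans; cong; subst; module ≡-Reasoning)
open import Relation.Nullary.Decidable using (yes; no; _×-dec_)
open import Relation.Nullary.Negation.Core using (¬_; contradiction)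

module Base (b : ℕ) .{{_ : NonZero b}} where

  -- Leading digits as intervals.

  -- x is the leading digit of n, at position j, whenever 0 < x < b.
  record Leads (n x j : ℕ) : Set where
    constructor leads
    field
      lower : x * b ^ j ≤ n
      upper : n < suc x * b ^ j

  *-^-shift : ∀ x j → x * b ^ suc j ≡ x * b ^ j * b
  *-^-shift x j = trans (cong (x *_) (*-comm b (b ^ j))) (sym (*-assoc x (b ^ j) b))

  -- A new lowest digit is less than `b`, so it moves `m * b` to a number still below `suc m * b`;
  -- both interval bounds are thus simply multiplied by `b`.
  fromDigits-leads : ∀ ds (x : Fin b) → ∃[ j ] Leads (fromDigits (ds ∷ʳ x)) (toℕ x) j
  fromDigits-leads [] x = 0 , leads (≤-reflexive eq) (s≤s (≤-reflexive (sym eq)))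
    where
    eq : toℕ x * 1 ≡ toℕ x + 0
    eq = trans (*-identityʳ (toℕ x)) (sym (+-identityʳ (toℕ x)))
  fromDigits-leads (d ∷ ds) x with fromDigits-leads ds x
  ... | j , leads lo up = suc j , leads lo′ up′
    where
    open ≤-Reasoning
    m = fromDigits (ds ∷ʳ x)
    lo′ : toℕ x * b ^ suc j ≤ toℕ d + m * b
    lo′ = begin
      toℕ x * b ^ suc j  ≡⟨ *-^-shift (toℕ x) j ⟩
      toℕ x * b ^ j * b  ≤⟨ *-monoˡ-≤ b lo ⟩
      m * b              ≤⟨ m≤n+m (m * b) (toℕ d) ⟩
      toℕ d + m * b      ∎
    up′ : toℕ d + m * b < suc (toℕ x) * b ^ suc j
    up′ = begin-strict
      toℕ d + m * b            <⟨ +-monoˡ-< (m * b) (toℕ<n d) ⟩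
      suc m * b                ≤⟨ *-monoˡ-≤ b up ⟩
      suc (toℕ x) * b ^ j * b  ≡⟨ *-^-shift (suc (toℕ x)) j ⟨
      suc (toℕ x) * b ^ suc j  ∎

  isLeadingDigit⇒leads : ∀ {n} {x : Fin b} → IsLeadingDigit b n x → ∃[ j ] Leads n (toℕ x) j
  isLeadingDigit⇒leads {x = x} (_ , ds , refl) = fromDigits-leads ds x

  -- Division by `b` strips the lowest digit and lowers the position by one; at position 0 the
  -- interval is a single point.
  leads⇒fromDigits : ∀ {n} (x : Fin b) j → Leads n (toℕ x) j →
                     ∃[ ds ] fromDigits (ds ∷ʳ x) ≡ n
  leads⇒fromDigits {n} x zero (leads lo up) = [] , trans (+-identityʳ (toℕ x))
    (≤-antisym (subst (_≤ n) (*-identityʳ (toℕ x)) lo)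
               (s≤s⁻¹ (subst (n <_) (*-identityʳ (suc (toℕ x))) up)))
  leads⇒fromDigits {n} x (suc j) (leads lo up) with leads⇒fromDigits {n / b} x j (leads lo′ up′)
    where
    lo′ : toℕ x * b ^ j ≤ n / b
    lo′ = subst (_≤ n / b) (m*n/n≡m (toℕ x * b ^ j) b)
            (/-monoˡ-≤ b (subst (_≤ n) (*-^-shift (toℕ x) j) lo))
    up′ : n / b < suc (toℕ x) * b ^ j
    up′ = m<n*o⇒m/o<n (subst (n <_) (*-^-shift (suc (toℕ x)) j) up)
  ... | ds , eq = fromℕ< (m%n<n n b) ∷ ds , (begin
      toℕ (fromℕ< (m%n<n n b)) + fromDigits (ds ∷ʳ x) * b  ≡⟨ cong (_+ fromDigits (ds ∷ʳ x) * b) (toℕ-fromℕ< (m%n<n n b)) ⟩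
      n % b + fromDigits (ds ∷ʳ x) * b                     ≡⟨ cong (λ m → n % b + m * b) eq ⟩
      n % b + n / b * b                                    ≡⟨ m≡m%n+[m/n]*n n b ⟨
      n                                                    ∎)
    where open ≡-Reasoning

  leads⇒isLeadingDigit : ∀ {n} (x : Fin b) j → toℕ x ≢ 0 → Leads n (toℕ x) j → IsLeadingDigit b n x
  leads⇒isLeadingDigit x j x≢0 l = x≢0 , leads⇒fromDigits x j l

  -- If `j < i`, the whole interval of `y` at `j` ends by `b ^ suc j`, hence no later than the
  -- interval of `x` at `i` starts.
  exponent-≤ : ∀ {n x y i j} → 0 < x → y < b → Leads n x i → Leads n y j → i ≤ j
  exponent-≤ {n} {x} {y} {i} {j} 0<x y<b (leads lo _) (leads _ up) =
    ≮⇒≥ λ j<i → <-irrefl refl (begin-strict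
      n              <⟨ up ⟩
      suc y * b ^ j  ≤⟨ *-monoˡ-≤ (b ^ j) y<b ⟩
      b ^ suc j      ≤⟨ ^-monoʳ-≤ b j<i ⟩
      b ^ i          ≤⟨ m≤n*m (b ^ i) x {{>-nonZero 0<x}} ⟩
      x * b ^ i      ≤⟨ lo ⟩
      n              ∎)
    where open ≤-Reasoning

  digit-≤ : ∀ {n x y j} → Leads n x j → Leads n y j → x ≤ y
  digit-≤ {n} {x} {y} {j} (leads lo _) (leads _ up) =
    s≤s⁻¹ (*-cancelʳ-< (b ^ j) x (suc y) (≤-<-trans lo up))

  leads-unique : ∀ {n x y i j} → 0 < x → x < b → 0 < y → y < b →
                 Leads n x i → Leads n y j → x ≡ y
  leads-unique 0<x x<b 0<y y<b l l′
    with refl ← ≤-antisym (exponent-≤ 0<x y<b l l′) (exponent-≤ 0<y x<b l′ l) =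
    ≤-antisym (digit-≤ l l′) (digit-≤ l′ l)

  -- Induction by counting up: the digit changes only when the upper end of its interval is reached.
  -- It then increases by one, or, from `b ∸ 1`, rolls over to 1 at the next position.
  leads-exists : 1 < b → ∀ n → 0 < n → ∃[ x ] ∃[ j ] (0 < x × x < b × Leads n x j)
  leads-exists 1<b (suc zero) _ = 1 , 0 , z<s , 1<b , leads ≤-refl ≤-refl
  leads-exists 1<b (suc n@(suc _)) _ with leads-exists 1<b n z<s
  ... | x , j , 0<x , x<b , leads lo up with m≤n⇒m<n∨m≡n up
  ...   | inj₁ up′ = x , j , 0<x , x<b , leads (m≤n⇒m≤1+n lo) up′
  ...   | inj₂ eq with m≤n⇒m<n∨m≡n x<b
  ...     | inj₁ x+1<b = suc x , j , z<s , x+1<b ,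
              leads (≤-reflexive (sym eq))
                    (subst (_< suc (suc x) * b ^ j) (sym eq) (*-monoˡ-< (b ^ j) {{m^n≢0 b j}} {suc x} ≤-refl))
  ...     | inj₂ refl = 1 , suc j , z<s , 1<b ,
              leads (≤-reflexive (trans (*-identityˡ (b ^ suc j)) (sym eq)))
                    (subst (_< 2 * b ^ suc j) (trans (*-identityˡ (b ^ suc j)) (sym eq))
                           (*-monoˡ-< (b ^ suc j) {{m^n≢0 b (suc j)}} {1} {2} ≤-refl))

  -- Consequences of the bound `b ^ 2 ∸ 1`.

  two-digit-bound : ∀ {d x} → d < b → x < b → d * b + x ≤ b ^ 2 ∸ 1
  two-digit-bound {d} {x} d<b x<b = m+n≤o⇒m≤o∸n (d * b + x) (begin
    d * b + x + 1    ≡⟨ trans (+-assoc (d * b) x 1) (cong (d * b +_) (+-comm x 1)) ⟩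
    d * b + suc x    ≤⟨ +-monoʳ-≤ (d * b) x<b ⟩
    d * b + b        ≡⟨ +-comm (d * b) b ⟩
    suc d * b        ≤⟨ *-monoˡ-≤ b d<b ⟩
    b * b            ≡⟨ cong (b *_) (*-identityʳ b) ⟨
    b ^ 2            ∎)
    where open ≤-Reasoning

  multiple<b²∸1 : ∀ {x} → 1 < b → x < b → x * b < b ^ 2 ∸ 1
  multiple<b²∸1 {x} 1<b x<b =
    -- The two-digit number with digits `x` and 1 gives the strict inequality.
    subst (_≤ b ^ 2 ∸ 1) (+-comm (x * b) 1) (two-digit-bound x<b 1<b)

  leads-exponent≥1 : ∀ {n x j} → 1 < b → x < b → b ^ 2 ∸ 1 ≤ n → Leads n x j → 1 ≤ j
  leads-exponent≥1 {j = suc _} _ _ _ _ = s≤s z≤n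
  leads-exponent≥1 {n} {x} {zero} 1<b x<b n≥ (leads _ up) = ⊥-elim (<-irrefl refl (begin-strict
    n           <⟨ up ⟩
    suc x * 1   ≡⟨ *-identityʳ (suc x) ⟩
    suc x       ≤⟨ x<b ⟩
    b           ≡⟨ *-identityˡ b ⟨
    1 * b       <⟨ multiple<b²∸1 1<b 1<b ⟩
    b ^ 2 ∸ 1   ≤⟨ n≥ ⟩
    n           ∎))
    where open ≤-Reasoning

  -- The critical exponent is 1: even the largest `x * b` with `x < b` falls short of `b ^ 2 ∸ 1`.
  multiple-exponent≥2 : ∀ {x j} → 1 < b → x < b → b ^ 2 ∸ 1 ≤ x * b ^ j → 2 ≤ j
  multiple-exponent≥2 {x} {j} 1<b x<b n≥ = ≮⇒≥ λ j<2 → <-irrefl refl (begin-strict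
    x * b ^ j   ≤⟨ *-monoʳ-≤ x (^-monoʳ-≤ b (s≤s⁻¹ j<2)) ⟩
    x * b ^ 1   ≡⟨ cong (x *_) (^-identityʳ b) ⟩
    x * b       <⟨ multiple<b²∸1 1<b x<b ⟩
    b ^ 2 ∸ 1   ≤⟨ n≥ ⟩
    x * b ^ j   ∎)
    where open ≤-Reasoning

  -- Parents and their children.

  parent-exists : ∀ {n x} → x < b → b ^ 2 ∸ 1 ≤ n → n ≢ x →
                  ∃[ k ] (0 < k × n ≡ k + (k % b * b + x))
  parent-exists {n} {x} x<b n≥ n≢x = k , n≢0⇒n>0 k≢0 , n≡
    where
    m = n ∸ x
    d = m % b
    d<b : d < b
    d<b = m%n<n m b
    d≤m/b : d ≤ m / b
    d≤m/b = subst (_≤ m / b) (m*n/n≡m d b)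
      (/-monoˡ-≤ b (m+n≤o⇒m≤o∸n (d * b) (≤-trans (two-digit-bound d<b x<b) n≥)))
    -- By `d≤m/b` nothing is truncated, so `k` below is `m` minus `d * b`, written so that its last
    -- digit is visibly `d`.
    e = m / b ∸ d
    k = d + e * b
    k%b≡d : k % b ≡ d
    k%b≡d = trans ([m+kn]%n≡m%n d e b) (m<n⇒m%n≡m d<b)
    x≤n : x ≤ n
    -- Here `x` is padded with a leading 0 to a two-digit number.
    x≤n = ≤-trans (≤-trans (m≤n+m x (0 * b)) (two-digit-bound (≤-<-trans z≤n x<b) x<b)) n≥
    n≡ : n ≡ k + (k % b * b + x)
    n≡ = begin
      n                              ≡⟨ m∸n+n≡m x≤n ⟨
      m + x                          ≡⟨ cong (_+ x) (m≡m%n+[m/n]*n m b) ⟩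
      d + m / b * b + x              ≡⟨ cong (λ q → d + q * b + x) (m∸n+n≡m d≤m/b) ⟨
      d + (e + d) * b + x            ≡⟨ solve 4 (λ d e b x → d :+ (e :+ d) :* b :+ x := d :+ e :* b :+ (d :* b :+ x)) refl d e b x ⟩
      k + (d * b + x)                ≡⟨ cong (λ r → k + (r * b + x)) k%b≡d ⟨
      k + (k % b * b + x)            ∎
      where
      open ≡-Reasoning
      open +-*-Solver
    k≢0 : k ≢ 0
    k≢0 k≡0 = n≢x (trans n≡ (trans (cong (λ k → k + (k % b * b + x)) k≡0)
      (cong (λ r → r * b + x) (m<n⇒m%n≡m {m = 0} (≤-<-trans z≤n x<b)))))

  -- If `M + y` reached `x * b ^ j`, it would still lead with `x`. It does reach `z * b ^ j`, since
  -- `x < b ≤ b ^ j`. So it leads with `z`, which makes `M + x` its immediate successor, at most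
  -- `x * b ^ j`.
  leading-digit-drop : ∀ {M x y i j} → 0 < y → y < x → x < b → 1 ≤ j →
                       Leads (M + x) x j → Leads (M + y) y i → M + x ≡ x * b ^ j
  leading-digit-drop {M} {x@(suc z)} {y} {i} {j} 0<y y<x@(s≤s y≤z) x<b 1≤j (leads lo up) ly =
    ≤-antisym (subst (_≤ x * b ^ j) eq below) lo
    where
    open ≤-Reasoning
    below : M + y < x * b ^ j
    below = ≰⇒> λ lo′ → <-irrefl
      (leads-unique {j = j} 0<y (<-trans y<x x<b) z<s x<b ly
        (leads lo′ (≤-<-trans (+-monoʳ-≤ M (<⇒≤ y<x)) up))) y<x
    x≤bʲ : x ≤ b ^ j
    x≤bʲ = begin
      x      ≤⟨ <⇒≤ x<b ⟩
      b      ≡⟨ ^-identityʳ b ⟨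
      b ^ 1  ≤⟨ ^-monoʳ-≤ b 1≤j ⟩
      b ^ j  ∎
    above : z * b ^ j ≤ M + y
    above = +-cancelˡ-≤ (b ^ j) (z * b ^ j) (M + y) (begin
      x * b ^ j         ≤⟨ lo ⟩
      M + x             ≤⟨ +-mono-≤ (m≤m+n M y) x≤bʲ ⟩
      M + y + b ^ j     ≡⟨ +-comm (M + y) (b ^ j) ⟩
      b ^ j + (M + y)   ∎)
    y≡z : y ≡ z
    y≡z = leads-unique {j = j} 0<y (<-trans y<x x<b) (<-≤-trans 0<y y≤z) (<-trans ≤-refl x<b)
            ly (leads above below)
    eq : suc (M + y) ≡ M + x
    eq = trans (sym (+-suc M y)) (cong (λ t → M + suc t) y≡z)

  successor-of-parent : ∀ {n x j} → 0 < x → x < b → 1 ≤ j → b ^ 2 ∸ 1 ≤ n → Leads n x j →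
                        n ≢ x → ¬ (2 ≤ x × n ≡ x * b ^ j) →
                        ∃[ k ] (k > 0 × IsCommaSuccessor b k n)
  successor-of-parent {n} {x} {j} 0<x x<b 1≤j n≥ ln n≢x ¬power
    with k , 0<k , n≡ ← parent-exists x<b n≥ n≢x =
    k , 0<k , child , minimal
    where
    M = k + k % b * b
    x′ = fromℕ< x<b
    x′≡x : toℕ x′ ≡ x
    x′≡x = toℕ-fromℕ< x<b
    child : CommaChild b k n
    child = x′
      , leads⇒isLeadingDigit x′ j (λ x′≡0 → <⇒≢ 0<x (sym (trans (sym x′≡x) x′≡0)))
          (subst (λ t → Leads n t j) (sym x′≡x) ln)
      , trans n≡ (cong (λ t → k + (k % b * b + t)) (sym x′≡x))
    n≡M+x : n ≡ M + x
    n≡M+x = trans n≡ (sym (+-assoc k (k % b * b) x))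
    minimal : ∀ m → CommaChild b k m → n ≤ m
    minimal m (y , ld@(y≢0 , _) , m≡) with x ≤? toℕ y | isLeadingDigit⇒leads ld
    ... | yes x≤y | _ = begin
        n                           ≡⟨ n≡ ⟩
        k + (k % b * b + x)         ≤⟨ +-monoʳ-≤ k (+-monoʳ-≤ (k % b * b) x≤y) ⟩
        k + (k % b * b + toℕ y)     ≡⟨ m≡ ⟨
        m                           ∎
      where open ≤-Reasoning
    -- All children of `k` have the form `M` plus their leading digit, so `m` is a drop from `n`;
    -- moreover `0 < y < x` yields `2 ≤ x`.
    ... | no x≰y | i , lm = contradiction
        (≤-<-trans (n≢0⇒n>0 y≢0) (≰⇒> x≰y) , trans n≡M+x
          (leading-digit-drop (n≢0⇒n>0 y≢0) (≰⇒> x≰y) x<b 1≤j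
            (subst (λ t → Leads t x j) n≡M+x ln)
            (subst (λ t → Leads t (toℕ y) i) (trans m≡ (sym (+-assoc k (k % b * b) (toℕ y)))) lm)))
        ¬power

  power-not-successor : ∀ {c i k} → 2 ≤ c → c < b → ¬ IsCommaSuccessor b k (c * b ^ i)
  power-not-successor {c@(suc a)} {i} {k} (s≤s 0<a) c<b ((x , ld@(x≢0 , _) , n≡) , minimal)
    with j , lx ← isLeadingDigit⇒leads ld =
    <-irrefl refl (subst (_≤ m) n≡suc-m (minimal m child))
    where
    a<b : a < b
    a<b = <-trans ≤-refl c<b
    instance
      bⁱ≢0 : NonZero (b ^ i)
      bⁱ≢0 = m^n≢0 b i
    x≡c : toℕ x ≡ c
    x≡c = leads-unique {j = i} (n≢0⇒n>0 x≢0) (toℕ<n x) z<s c<b lx (leads ≤-refl (*-monoˡ-< (b ^ i) {c} ≤-refl))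
    m = k + (k % b * b + a)
    n≡suc-m : c * b ^ i ≡ suc m
    n≡suc-m = begin
      c * b ^ i                  ≡⟨ n≡ ⟩
      k + (k % b * b + toℕ x)    ≡⟨ cong (λ t → k + (k % b * b + t)) x≡c ⟩
      k + (k % b * b + suc a)    ≡⟨ cong (k +_) (+-suc (k % b * b) a) ⟩
      k + suc (k % b * b + a)    ≡⟨ +-suc k (k % b * b + a) ⟩
      suc m                      ∎
      where open ≡-Reasoning
    y = fromℕ< a<b
    y≡a : toℕ y ≡ a
    y≡a = toℕ-fromℕ< a<b
    lm : Leads m a i
    -- `suc m` is exactly the excluded upper end of the interval of `a` at position `i`.
    lm = leads (s≤s⁻¹ (subst (a * b ^ i <_) n≡suc-m (*-monoˡ-< (b ^ i) {a} ≤-refl)))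
               (≤-reflexive (sym n≡suc-m))
    child : CommaChild b k m
    child = y
      , leads⇒isLeadingDigit y i (λ y≡0 → <⇒≢ 0<a (sym (trans (sym y≡a) y≡0)))
          (subst (λ t → Leads m t i) (sym y≡a) lm)
      , cong (λ t → k + (k % b * b + t)) (sym y≡a)

theorem5p4 : (b : ℕ) .{{_ : NonZero b}} → b ≥ 3 →
    (n : ℕ) → n ≥ b ^ 2 ∸ 1 →
    (¬ (∃[ k ] (k > 0 × IsCommaSuccessor b k n))) ⇔ (∃[ c ] ∃[ i ] (i ≥ 2 × 2 ≤ c × c ≤ b ∸ 1 × n ≡ c * b ^ i))
theorem5p4 b b≥3 n n≥ = mk⇔ to from
  where
  open Base b
  1<b : 1 < b
  1<b = <-trans ≤-refl b≥3
  -- This keeps `n` apart from its own leading digit, which makes the parent positive.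
  b<n : b < n
  b<n = subst (_< n) (*-identityˡ b) (<-≤-trans (multiple<b²∸1 1<b 1<b) n≥)
  0<n : 0 < n
  0<n = ≤-<-trans z≤n b<n

  to : ¬ (∃[ k ] (k > 0 × IsCommaSuccessor b k n)) →
       ∃[ c ] ∃[ i ] (i ≥ 2 × 2 ≤ c × c ≤ b ∸ 1 × n ≡ c * b ^ i)
  to ¬successor with x , j , 0<x , x<b , ln ← leads-exists 1<b n 0<n
    -- Powers of `b`, with `x` equal to 1, go to the second branch: a smaller child would have to
    -- lead with 0.
    with (2 ≤? x) ×-dec (n ≟ x * b ^ j)
  ... | yes (2≤x , n≡) = x , j
      , multiple-exponent≥2 1<b x<b (subst (b ^ 2 ∸ 1 ≤_) n≡ n≥)
      , 2≤x , <⇒≤pred x<b , n≡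
  ... | no ¬power = contradiction
      (successor-of-parent 0<x x<b (leads-exponent≥1 1<b x<b n≥ ln) n≥ ln
        (>⇒≢ (<-trans x<b b<n)) ¬power)
      ¬successor

  from : ∃[ c ] ∃[ i ] (i ≥ 2 × 2 ≤ c × c ≤ b ∸ 1 × n ≡ c * b ^ i) →
         ¬ (∃[ k ] (k > 0 × IsCommaSuccessor b k n))
  from (c , i , _ , 2≤c , c≤b-1 , refl) (k , _ , successor) =
    power-not-successor {c} {i} {k} 2≤c (m≤pred[n]⇒suc[m]≤n c≤b-1) successor
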